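{- Let $n$ and $k$ be positive integers with $k\leq (n+1)/2$. Then \[\mathrm{BoNa}(n,k)=\frac{1}{n} \binom{n}{k-1} \sum_{j=0}^{k-1} 2^j \binom{k-1}{j}\binom{n-k+1}{j+1}.\]
   Context: A binary plane tree is a rooted plane tree on unlabeled vertices in which every non-leaf vertex has one or two children, and every child is a left child or a right child, even if it is the only child of its parent. A 0-1-tree is a binary plane tree in which every vertex that has two children is labeled 0 or 1 (no other vertex is labeled). A right edge is an edge connecting a vertex to its right child. For $n\ge 1$, the Boolean-Narayana number $\mathrm{BoNa}(n,k)$ is the number of 0-1-trees on $n$ vertices that have exactly $k-1$ right edges. -}

module Defs where

open import Data.Fin.Base using (Fin; zero; suc)
import Data.Fin.Properties as Fin
open import Data.List.Base using (List; []; _∷_; _++_; map; length; lookup; filter; deduplicate; allFin; cartesianProductWith)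
open import Data.List.Membership.Propositional using (_∈_)
open import Data.List.Membership.Propositional.Properties
  using (∈-map⁺; ∈-++⁺ˡ; ∈-++⁺ʳ; ∈-allFin; ∈-cartesianProductWith⁺; ∈-filter⁺; ∈-filter⁻; ∈-deduplicate⁺; ∈-deduplicate⁻; ∈-lookup)
import Data.List.Relation.Unary.All as All
open import Data.List.Relation.Unary.AllPairs using ([]; _∷_)
open import Data.List.Relation.Unary.Any using (here; there; index)
open import Data.List.Relation.Unary.Any.Properties using (lookup-index)
open import Data.List.Relation.Unary.Unique.DecPropositional.Properties using (deduplicate-!)
open import Data.List.Relation.Unary.Unique.Propositional using (Unique)
open import Data.Nat.Base using (ℕ; zero; suc; _+_; _≤_; s≤s)
import Data.Nat.Properties as ℕ
open import Data.Product.Base using (Σ; _×_; _,_; proj₁; proj₂)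
open import Function.Bundles using (_↔_; mk↔ₛ′)
open import Relation.Binary.Definitions using (DecidableEquality)
open import Relation.Binary.PropositionalEquality
  using (_≡_; refl; sym; cong; cong₂)
open import Relation.Nullary using (yes; no; contradiction)
open import Relation.Nullary.Decidable using (map′; _×-dec_)
open import Relation.Unary using (Pred; Decidable; Irrelevant)

-- There is no empty tree, and the label sits on `both` only.
data ZeroOneTree : Set where
  leaf  : ZeroOneTree
  left  : ZeroOneTree → ZeroOneTree
  right : ZeroOneTree → ZeroOneTree
  both  : Fin 2 → ZeroOneTree → ZeroOneTree → ZeroOneTree

vertices : ZeroOneTree → ℕ
vertices leaf         = 1
vertices (left t)     = 1 + vertices t
vertices (right t)    = 1 + vertices t
vertices (both _ l r) = 1 + (vertices l + vertices r)

rightEdges : ZeroOneTree → ℕ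
rightEdges leaf         = 0
rightEdges (left t)     = rightEdges t
rightEdges (right t)    = 1 + rightEdges t
rightEdges (both _ l r) = 1 + (rightEdges l + rightEdges r)

-- `rightEdges t + 1 ≡ k` rather than `rightEdges t ≡ k ∸ 1`, so that
-- truncated subtraction does not make k = 0 behave like k = 1.
Counted : ℕ → ℕ → Pred ZeroOneTree _
Counted n k t = vertices t ≡ n × rightEdges t + 1 ≡ k

private
  infix 4 _≟_
  _≟_ : DecidableEquality ZeroOneTree
  leaf       ≟ leaf          = yes refl
  leaf       ≟ left _        = no λ ()
  leaf       ≟ right _       = no λ ()
  leaf       ≟ both _ _ _    = no λ ()
  left _     ≟ leaf          = no λ ()
  left t     ≟ left u        = map′ (cong left) (λ { refl → refl }) (t ≟ u)
  left _     ≟ right _       = no λ ()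
  left _     ≟ both _ _ _    = no λ ()
  right _    ≟ leaf          = no λ ()
  right _    ≟ left _        = no λ ()
  right t    ≟ right u       = map′ (cong right) (λ { refl → refl }) (t ≟ u)
  right _    ≟ both _ _ _    = no λ ()
  both _ _ _ ≟ leaf          = no λ ()
  both _ _ _ ≟ left _        = no λ ()
  both _ _ _ ≟ right _       = no λ ()
  both a l r ≟ both b l′ r′  =
    map′ (λ { (refl , refl , refl) → refl }) (λ { refl → refl , refl , refl })
         (a Fin.≟ b ×-dec l ≟ l′ ×-dec r ≟ r′)

  -- All trees with at most h vertices on every root-to-leaf path.
  trees : ℕ → List ZeroOneTree
  trees zero    = []
  trees (suc h) =
    leaf ∷ map left (trees h) ++ map right (trees h) ++
    cartesianProductWith (λ f → f)
      (cartesianProductWith both (allFin 2) (trees h)) (trees h)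

  trees-complete : ∀ h t → vertices t ≤ h → t ∈ trees h
  trees-complete (suc h) leaf         _       = here refl
  trees-complete (suc h) (left t)     (s≤s p) =
    there (∈-++⁺ˡ (∈-map⁺ left (trees-complete h t p)))
  trees-complete (suc h) (right t)    (s≤s p) =
    there (∈-++⁺ʳ (map left (trees h)) (∈-++⁺ˡ (∈-map⁺ right (trees-complete h t p))))
  trees-complete (suc h) (both a l r) (s≤s p) =
    there (∈-++⁺ʳ (map left (trees h)) (∈-++⁺ʳ (map right (trees h))
      (∈-cartesianProductWith⁺ (λ f → f)
        (∈-cartesianProductWith⁺ both (∈-allFin a)
          (trees-complete h l (ℕ.m+n≤o⇒m≤o (vertices l) p)))
        (trees-complete h r (ℕ.m+n≤o⇒n≤o (vertices l) p)))))

  lookup-injective : ∀ {a} {A : Set a} {xs : List A} → Unique xs →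
                     ∀ i j → lookup xs i ≡ lookup xs j → i ≡ j
  lookup-injective (_ ∷ _) zero    zero    _  = refl
  lookup-injective (p ∷ _) zero    (suc j) eq = contradiction eq (All.lookup p (∈-lookup j))
  lookup-injective (p ∷ _) (suc i) zero    eq = contradiction (sym eq) (All.lookup p (∈-lookup i))
  lookup-injective (_ ∷ u) (suc i) (suc j) eq = cong suc (lookup-injective u i j eq)

  finite : ∀ {a p} {A : Set a} {P : Pred A p} →
           DecidableEquality A → Decidable P → Irrelevant P →
           (xs : List A) → (∀ {x} → P x → x ∈ xs) →
           Σ ℕ λ N → Σ A P ↔ Fin N
  finite {A = A} {P = P} _≟ᴬ_ P? irr xs complete =
    length ys , mk↔ₛ′ to from to∘from from∘to
    where
    ys = deduplicate _≟ᴬ_ (filter P? xs)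

    mem : ∀ {x} → P x → x ∈ ys
    mem px = ∈-deduplicate⁺ _≟ᴬ_ (∈-filter⁺ P? (complete px) px)

    to : Σ A P → Fin (length ys)
    to (_ , px) = index (mem px)

    from : Fin (length ys) → Σ A P
    from i = lookup ys i ,
      proj₂ (∈-filter⁻ P? {xs = xs} (∈-deduplicate⁻ _≟ᴬ_ (filter P? xs) (∈-lookup i)))

    to∘from : ∀ i → to (from i) ≡ i
    to∘from i = lookup-injective (deduplicate-! _≟ᴬ_ (filter P? xs)) _ _
      (sym (lookup-index (mem (proj₂ (from i)))))

    ext : ∀ {x y} {px : P x} {py : P y} → x ≡ y → (x , px) ≡ (y , py)
    ext refl = cong (_ ,_) (irr _ _)

    from∘to : ∀ x → from (to x) ≡ x
    from∘to (_ , px) = ext (sym (lookup-index (mem px)))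

finitelyMany : ∀ n k → Σ ℕ λ N → Σ ZeroOneTree (Counted n k) ↔ Fin N
finitelyMany n k = finite _≟_
  (λ t → vertices t ℕ.≟ n ×-dec rightEdges t + 1 ℕ.≟ k)
  (λ (p , q) (p′ , q′) → cong₂ _,_ (ℕ.≡-irrelevant p p′) (ℕ.≡-irrelevant q q′))
  (trees n)
  (λ {t} (p , _) → trees-complete n t (ℕ.≤-reflexive p))

-- The cardinality of the set of counted trees: by `BoNa-counts` it does not
-- depend on the enumeration used to establish finiteness.
BoNa : ℕ → ℕ → ℕ
BoNa n k = proj₁ (finitelyMany n k)

BoNa-counts : ∀ n k → Σ ZeroOneTree (Counted n k) ↔ Fin (BoNa n k)
BoNa-counts n k = proj₂ (finitelyMany n k)

{-# OPTIONS --safe #-}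
-- A forest of r trees on n ≥ 1 vertices, with b vertices having only a left
-- child, c having only a right child and d having two children, has r + d
-- leaves and n = r + b + c + 2 d. Deleting the root of the first tree gives a
-- recurrence for the number of such forests, solved by
--   2^d r (n − 1)! / ((r + d)! b! c! d!).
-- For r = 1, c = k − 1 − j and d = j, the multinomial coefficient n! / (...)
-- factors into the three binomials of the j-th summand.
module Submission where

open import Defs
open import Data.Empty using (⊥-elim)
open import Data.Fin.Base using (Fin; zero; suc; toℕ; fromℕ<)
open import Data.Fin.Permutation using (↔⇒≡)
open import Data.Fin.Properties using (+↔⊎; *↔×; toℕ<n; toℕ-fromℕ<; toℕ-injective)
open import Data.Integer.Base as ℤ using (+_)
import Data.Integer.Properties as ℤ
open import Data.List.Base using (map; upTo; applyUpTo)
open import Data.List.Properties using (map-upTo)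
open import Data.Nat.Base hiding (_/_)
open import Data.Nat.Combinatorics using (_C_; nCk≡n!/k![n-k]!; [n∸k]!k!∣n!; k>n⇒nCk≡0)
open import Data.Nat.DivMod using (m/n*n≡m)
open import Data.Nat.Divisibility using (_∣_)
open import Data.Nat.ListAction using (sum)
open import Data.Nat.Properties
open import Data.Nat.Tactic.RingSolver using (solve-∀)
open import Data.Product.Base using (Σ; _×_; _,_)
open import Data.Product.Function.NonDependent.Propositional using (_×-↔_)
open import Data.Rational.Base as ℚ using (_/_)
import Data.Rational.Properties as ℚ
import Data.Rational.Unnormalised.Base as ℚᵘ
import Data.Rational.Unnormalised.Properties as ℚᵘ
open import Data.Sum.Base using (_⊎_; inj₁; inj₂)
open import Data.Sum.Function.Propositional using (_⊎-↔_)
open import Data.Vec.Base using (Vec; []; _∷_)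
open import Function.Base using (_∘_)
open import Function.Bundles using (_↔_; mk↔ₛ′)
open import Function.Construct.Identity using (↔-id)
open import Function.Properties.Inverse using (↔-sym; ↔-trans)
open import Relation.Binary.PropositionalEquality
open import Relation.Nullary using (¬_; Irrelevant)

-- Counting a type as a finite sum over fibres

×-irrelevant : ∀ {a b} {A : Set a} {B : Set b} →
               Irrelevant A → Irrelevant B → Irrelevant (A × B)
×-irrelevant irrA irrB (a , b) (a′ , b′) = cong₂ _,_ (irrA a a′) (irrB b b′)

≡²-irrelevant : {a b c d : ℕ} → Irrelevant (a ≡ b × c ≡ d)
≡²-irrelevant = ×-irrelevant ≡-irrelevant ≡-irrelevant

≡³-irrelevant : {a b c d e f : ℕ} → Irrelevant (a ≡ b × c ≡ d × e ≡ f)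
≡³-irrelevant = ×-irrelevant ≡-irrelevant ≡²-irrelevant

Σ-≡ : ∀ {a p} {A : Set a} {P : A → Set p} {x} → Irrelevant (P x) →
      {p q : P x} → _≡_ {A = Σ A P} (x , p) (x , q)
Σ-≡ irr = cong (_ ,_) (irr _ _)

empty↔Fin0 : ∀ {a} {A : Set a} → ¬ A → A ↔ Fin 0
empty↔Fin0 ¬a = mk↔ₛ′ (λ a → ⊥-elim (¬a a)) (λ ()) (λ ()) (λ a → ⊥-elim (¬a a))

-- Sorting by a bounded statistic turns a count into a finite sum, by `Σ-Fin`. The statistic used
-- later is `boths`, whose value is the summation index j.
fibres : ∀ {a p} {A : Set a} {P : A → Set p} (f : A → ℕ) (n : ℕ) →
         (∀ {x} → P x → f x < n) →
         Σ A P ↔ Σ (Fin n) (λ j → Σ A (λ x → P x × f x ≡ toℕ j))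
fibres {A = A} {P = P} f n bound = mk↔ₛ′ to from to∘from from∘to
  where
  F = Σ (Fin n) (λ j → Σ A (λ x → P x × f x ≡ toℕ j))

  to : Σ A P → F
  to (x , p) = fromℕ< (bound p) , x , p , sym (toℕ-fromℕ< (bound p))

  from : F → Σ A P
  from (_ , x , p , _) = x , p

  -- The indices are kept as separate variables so that `i ≡ j` can be matched with `refl`; then
  -- only the two proofs about `f x` can differ.
  unique : ∀ {i j x} {p : P x} {e : f x ≡ toℕ i} {e′ : f x ≡ toℕ j} → i ≡ j →
           _≡_ {A = F} (i , x , p , e) (j , x , p , e′)
  unique {i} {x = x} refl = cong (λ q → i , x , q) (Σ-≡ ≡-irrelevant)

  to∘from : ∀ y → to (from y) ≡ y
  to∘from (j , x , p , e) = unique (toℕ-injective (trans (toℕ-fromℕ< (bound p)) e))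

  from∘to : ∀ x → from (to x) ≡ x
  from∘to _ = refl

Σ-Fin : ∀ {a} n {A : Fin n → Set a} (f : ℕ → ℕ) → (∀ j → A j ↔ Fin (f (toℕ j))) →
        Σ (Fin n) A ↔ Fin (sum (applyUpTo f n))
Σ-Fin zero    f e = empty↔Fin0 λ ()
Σ-Fin (suc n) {A} f e = ↔-trans uncons
  (↔-trans (e zero ⊎-↔ Σ-Fin n (f ∘ suc) (e ∘ suc)) (↔-sym +↔⊎))
  where
  uncons : Σ (Fin (suc n)) A ↔ (A zero ⊎ Σ (Fin n) (A ∘ suc))
  uncons = mk↔ₛ′ (λ { (zero , x) → inj₁ x ; (suc j , x) → inj₂ (j , x) })
                 (λ { (inj₁ x) → zero , x ; (inj₂ (j , x)) → suc j , x })
                 (λ { (inj₁ _) → refl ; (inj₂ _) → refl })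
                 (λ { (zero , _) → refl ; (suc _ , _) → refl })

-- Vertex types in trees and forests

onlyRights : ZeroOneTree → ℕ
onlyRights leaf         = 0
onlyRights (left t)     = onlyRights t
onlyRights (right t)    = 1 + onlyRights t
onlyRights (both _ l r) = onlyRights l + onlyRights r

boths : ZeroOneTree → ℕ
boths leaf         = 0
boths (left t)     = boths t
boths (right t)    = boths t
boths (both _ l r) = 1 + (boths l + boths r)

-- Each right edge starts at its own vertex, which has either only a right child or two children.
rightEdges≡ : ∀ t → rightEdges t ≡ onlyRights t + boths t
rightEdges≡ leaf         = refl
rightEdges≡ (left t)     = rightEdges≡ t
rightEdges≡ (right t)    = cong suc (rightEdges≡ t)
rightEdges≡ (both _ l r) = trans
  (cong suc (cong₂ _+_ (rightEdges≡ l) (rightEdges≡ r)))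
  (regroup (onlyRights l) (boths l) (onlyRights r) (boths r))
  where
  regroup : ∀ a b c d → suc (a + b + (c + d)) ≡ a + c + suc (b + d)
  regroup = solve-∀

total : (ZeroOneTree → ℕ) → ∀ {r} → Vec ZeroOneTree r → ℕ
total f []       = 0
total f (t ∷ ts) = f t + total f ts

-- The number b of vertices with only a left child is determined by these data through n = r + b + c
-- + 2 d.
Profile : ℕ → ℕ → ℕ → ∀ {r} → Vec ZeroOneTree r → Set
Profile n c d ts = total vertices ts ≡ n × total onlyRights ts ≡ c × total boths ts ≡ d

Forest : ℕ → ℕ → ℕ → ℕ → Set
Forest r n c d = Σ (Vec ZeroOneTree r) (Profile n c d)

-- Stands for f (n - 1) with the value 0 at n = 0, where truncated subtraction would give f 0.
shift : (ℕ → ℕ) → ℕ → ℕ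
shift f zero    = 0
shift f (suc n) = f n

-- The four summands correspond to a first root that is a leaf, has only a left child, has only a
-- right child, or has two children. In the last case the label gives the factor 2 and the number of
-- trees grows by one.
forests : ℕ → ℕ → ℕ → ℕ → ℕ
forests zero    zero    zero    zero    = 1
forests zero    zero    zero    (suc _) = 0
forests zero    zero    (suc _) _       = 0
forests zero    (suc _) _       _       = 0
forests (suc r) zero    c       d       = 0
forests (suc r) (suc n) c       d       =
  forests r n c d + (forests (suc r) n c d +
  (shift (λ c′ → forests (suc r) n c′ d) c +
   2 * shift (λ d′ → forests (suc (suc r)) n c d′) d))

-- What remains after deleting a root with only a right child (Forestᶜ) or with
-- two children (Forestᵈ): the `suc` accounts for that root.
Forestᶜ : ℕ → ℕ → ℕ → ℕ → Set
Forestᶜ r n c d = Σ (Vec ZeroOneTree r) λ ts →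
  total vertices ts ≡ n × suc (total onlyRights ts) ≡ c × total boths ts ≡ d

Forestᵈ : ℕ → ℕ → ℕ → ℕ → Set
Forestᵈ r n c d = Σ (Vec ZeroOneTree r) λ ts →
  total vertices ts ≡ n × total onlyRights ts ≡ c × suc (total boths ts) ≡ d

-- Deleting the root of the first tree

-- The summand records the type of the deleted root and `Fin 2` its label, so the deletion can be
-- undone. Two subtrees of the root become the first two trees.
removeRoot : ∀ r n c d → Forest (suc r) (suc n) c d ↔
  (Forest r n c d ⊎ (Forest (suc r) n c d ⊎ (Forestᶜ (suc r) n c d ⊎
   (Fin 2 × Forestᵈ (suc (suc r)) n c d))))
removeRoot r n c d = mk↔ₛ′ to from to∘from from∘to
  where
  R = Forest r n c d ⊎ (Forest (suc r) n c d ⊎ (Forestᶜ (suc r) n c d ⊎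
   (Fin 2 × Forestᵈ (suc (suc r)) n c d)))

  to : Forest (suc r) (suc n) c d → R
  to (leaf ∷ ts , v , p , q) = inj₁ (ts , suc-injective v , p , q)
  to (left t ∷ ts , v , p , q) = inj₂ (inj₁ (t ∷ ts , suc-injective v , p , q))
  to (right t ∷ ts , v , p , q) = inj₂ (inj₂ (inj₁ (t ∷ ts , suc-injective v , p , q)))
  to (both i l r ∷ ts , v , p , q) = inj₂ (inj₂ (inj₂ (i , l ∷ r ∷ ts ,
    trans (sym (+-assoc (vertices l) _ _)) (suc-injective v) ,
    trans (sym (+-assoc (onlyRights l) _ _)) p ,
    trans (cong suc (sym (+-assoc (boths l) _ _))) q)))

  from : R → Forest (suc r) (suc n) c d
  from (inj₁ (ts , v , p , q)) = leaf ∷ ts , cong suc v , p , q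
  from (inj₂ (inj₁ (t ∷ ts , v , p , q))) = left t ∷ ts , cong suc v , p , q
  from (inj₂ (inj₂ (inj₁ (t ∷ ts , v , p , q)))) = right t ∷ ts , cong suc v , p , q
  from (inj₂ (inj₂ (inj₂ (i , l ∷ r ∷ ts , v , p , q)))) = both i l r ∷ ts ,
    cong suc (trans (+-assoc (vertices l) _ _) v) ,
    trans (+-assoc (onlyRights l) _ _) p ,
    trans (cong suc (+-assoc (boths l) _ _)) q

  to∘from : ∀ y → to (from y) ≡ y
  to∘from (inj₁ _) = cong inj₁ (Σ-≡ ≡³-irrelevant)
  to∘from (inj₂ (inj₁ (_ ∷ _ , _))) = cong (inj₂ ∘ inj₁) (Σ-≡ ≡³-irrelevant)
  to∘from (inj₂ (inj₂ (inj₁ (_ ∷ _ , _)))) =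
    cong (inj₂ ∘ inj₂ ∘ inj₁) (Σ-≡ ≡³-irrelevant)
  to∘from (inj₂ (inj₂ (inj₂ (i , _ ∷ _ ∷ _ , _)))) =
    cong (λ f → inj₂ (inj₂ (inj₂ (i , f)))) (Σ-≡ ≡³-irrelevant)

  from∘to : ∀ x → from (to x) ≡ x
  from∘to (leaf ∷ _ , _) = Σ-≡ ≡³-irrelevant
  from∘to (left _ ∷ _ , _) = Σ-≡ ≡³-irrelevant
  from∘to (right _ ∷ _ , _) = Σ-≡ ≡³-irrelevant
  from∘to (both _ _ _ ∷ _ , _) = Σ-≡ ≡³-irrelevant

vertices+n≢0 : ∀ t {n} → vertices t + n ≢ 0
vertices+n≢0 leaf         ()
vertices+n≢0 (left _)     ()
vertices+n≢0 (right _)    ()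
vertices+n≢0 (both _ _ _) ()

forests-counts : ∀ r n c d → Forest r n c d ↔ Fin (forests r n c d)
forests-counts zero zero zero zero = mk↔ₛ′ (λ _ → zero) (λ _ → [] , refl , refl , refl)
  (λ { zero → refl }) (λ { ([] , _) → Σ-≡ ≡³-irrelevant })
forests-counts zero zero zero (suc _)  = empty↔Fin0 λ { ([] , _ , _ , ()) }
forests-counts zero zero (suc _) _     = empty↔Fin0 λ { ([] , _ , () , _) }
forests-counts zero (suc _) _ _        = empty↔Fin0 λ { ([] , () , _) }
forests-counts (suc r) zero c d        = empty↔Fin0 λ { (t ∷ _ , v , _) → vertices+n≢0 t v }
forests-counts (suc r) (suc n) c d     = ↔-trans (removeRoot r n c d)
  (forests-counts r n c d ⊎ꟳ (forests-counts (suc r) n c d ⊎ꟳ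
  (rights c ⊎ꟳ ↔-trans (↔-id _ ×-↔ twos d) (↔-sym *↔×))))
  where
  infixr 1 _⊎ꟳ_
  _⊎ꟳ_ : ∀ {A B : Set} {m n} → A ↔ Fin m → B ↔ Fin n → (A ⊎ B) ↔ Fin (m + n)
  e ⊎ꟳ f = ↔-trans (e ⊎-↔ f) (↔-sym +↔⊎)

  -- At c = 0 the deleted root cannot have had only a right child, which matches the 0 of `shift`.
  rights : ∀ c → Forestᶜ (suc r) n c d ↔ Fin (shift (λ c′ → forests (suc r) n c′ d) c)
  rights zero    = empty↔Fin0 λ { (_ , _ , () , _) }
  rights (suc c) = ↔-trans
    (mk↔ₛ′ (λ (ts , v , p , q) → ts , v , suc-injective p , q)
           (λ (ts , v , p , q) → ts , v , cong suc p , q)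
           (λ _ → Σ-≡ ≡³-irrelevant)
           (λ _ → Σ-≡ ≡³-irrelevant))
    (forests-counts (suc r) n c d)

  twos : ∀ d → Forestᵈ (suc (suc r)) n c d ↔
               Fin (shift (λ d′ → forests (suc (suc r)) n c d′) d)
  twos zero    = empty↔Fin0 λ { (_ , _ , _ , ()) }
  twos (suc d) = ↔-trans
    (mk↔ₛ′ (λ (ts , v , p , q) → ts , v , p , suc-injective q)
           (λ (ts , v , p , q) → ts , v , p , cong suc q)
           (λ _ → Σ-≡ ≡³-irrelevant)
           (λ _ → Σ-≡ ≡³-irrelevant))
    (forests-counts (suc (suc r)) n c d)

-- Boolean-Narayana numbers as sums of forest counts

-- Of the m right edges, j start at vertices with two children, so by `rightEdges≡` the other
-- `m ∸ j` start at vertices with only a right child.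
fibre↔Forest : ∀ n m j → j ≤ m →
  Σ ZeroOneTree (λ t → Counted n (suc m) t × boths t ≡ j) ↔ Forest 1 n (m ∸ j) j
fibre↔Forest n m j j≤m = mk↔ₛ′ to from (λ { (_ ∷ [] , _) → Σ-≡ ≡³-irrelevant })
  (λ _ → Σ-≡ (×-irrelevant ≡²-irrelevant ≡-irrelevant))
  where
  to : Σ ZeroOneTree (λ t → Counted n (suc m) t × boths t ≡ j) → Forest 1 n (m ∸ j) j
  to (t , (v , e) , s) =
    t ∷ [] , trans (+-identityʳ _) v , trans (+-identityʳ _) onlyRights≡ , trans (+-identityʳ _) s
    where
    onlyRights≡ : onlyRights t ≡ m ∸ j
    onlyRights≡ = trans (sym (m+n∸n≡m (onlyRights t) (boths t)))
      (cong₂ _∸_ (trans (sym (rightEdges≡ t))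
        (suc-injective (trans (+-comm 1 (rightEdges t)) e))) s)

  from : Forest 1 n (m ∸ j) j → Σ ZeroOneTree (λ t → Counted n (suc m) t × boths t ≡ j)
  from (t ∷ [] , v , p , q) = t , (trans (sym (+-identityʳ _)) v , (begin
    rightEdges t + 1              ≡⟨ +-comm (rightEdges t) 1 ⟩
    suc (rightEdges t)            ≡⟨ cong suc (rightEdges≡ t) ⟩
    suc (onlyRights t + boths t)  ≡⟨ cong suc (cong₂ _+_ (trans (sym (+-identityʳ _)) p) boths≡) ⟩
    suc (m ∸ j + j)               ≡⟨ cong suc (m∸n+n≡m j≤m) ⟩
    suc m                         ∎)) , boths≡
    where
    open ≡-Reasoning
    boths≡ : boths t ≡ j
    boths≡ = trans (sym (+-identityʳ _)) q

-- Two enumerations of the same set have equal length by `↔⇒≡`, so the listing behind `BoNa` is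
-- never unfolded.
BoNa≡sum : ∀ n m → BoNa n (suc m) ≡ sum (applyUpTo (λ j → forests 1 n (m ∸ j) j) (suc m))
BoNa≡sum n m = ↔⇒≡ (↔-trans (↔-sym (BoNa-counts n (suc m)))
  (↔-trans (fibres boths (suc m) (λ {t} → bound t))
  (Σ-Fin (suc m) (λ j → forests 1 n (m ∸ j) j) λ j → ↔-trans
    (fibre↔Forest n m (toℕ j) (s≤s⁻¹ (toℕ<n j)))
    (forests-counts 1 n (m ∸ toℕ j) (toℕ j)))))
  where
  -- Each vertex with two children has a right edge of its own, hence j ≤ m.
  bound : ∀ t → Counted n (suc m) t → boths t < suc m
  bound t (_ , e) = begin-strict
    boths t                  ≤⟨ m≤n+m (boths t) (onlyRights t) ⟩
    onlyRights t + boths t   ≡⟨ rightEdges≡ t ⟨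
    rightEdges t             <⟨ n<1+n _ ⟩
    suc (rightEdges t)       ≡⟨ +-comm 1 _ ⟩
    rightEdges t + 1         ≡⟨ e ⟩
    suc m                    ∎
    where open ≤-Reasoning

-- Closed form of the forest counts

-- Since n = r + b + c + 2 d, the bound would make b negative. In the recurrence, every summand
-- either is 0 by `shift` or inherits the bound.
forests≡0 : ∀ r n c d → n < r + c + (d + d) → forests r n c d ≡ 0
forests≡0 zero    zero    zero    (suc d) _ = refl
forests≡0 zero    zero    (suc c) d       _ = refl
forests≡0 zero    (suc n) c       d       _ = refl
forests≡0 (suc r) zero    c       d       _ = refl
forests≡0 (suc r) (suc n) c       d       (s<s p) =
  cong₂ _+_ (forests≡0 r n c d p) (cong₂ _+_ (forests≡0 (suc r) n c d (m<n⇒m<1+n p))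
    (cong₂ _+_ (rights c p) (cong (2 *_) (twos d p))))
  where
  rights : ∀ c → n < r + c + (d + d) → shift (λ c′ → forests (suc r) n c′ d) c ≡ 0
  rights zero    _ = refl
  rights (suc c) p = forests≡0 (suc r) n c d (subst (λ x → n < x + (d + d)) (+-suc r c) p)

  twos : ∀ d → n < r + c + (d + d) → shift (λ d′ → forests (suc (suc r)) n c d′) d ≡ 0
  twos zero    _ = refl
  twos (suc d) p = forests≡0 (suc (suc r)) n c d (subst (n <_) (regroup r c d) p)
    where
    regroup : ∀ r c d → r + c + (suc d + suc d) ≡ suc (suc r) + c + (d + d)
    regroup = solve-∀

-- The denominator of the multinomial coefficient for a leaves, b vertices with only a left child, c
-- with only a right child and d with two children.
weight : ℕ → ℕ → ℕ → ℕ → ℕ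
weight a b c d = a ! * b ! * c ! * d !

-- Each kind of deleted root lowers the argument of one factorial in the weight,
-- so after cancelling 2^d n! the recurrence reduces to
-- (r + 1 + d) r + (r + 1) b + (r + 1) c + (r + 2) d = (r + 1) (r + b + c + 2 d).
forests-weight : ∀ n r b c d → n ≡ r + b + c + (d + d) →
  forests (suc r) (suc n) c d * weight (suc r + d) b c d ≡ 2 ^ d * (suc r * n !)
forests-weight zero zero zero zero zero refl = refl
forests-weight (suc n) r b c d eq = begin
  (A₁ + (A₂ + (A₃ + 2 * A₄))) * w
    ≡⟨ distribute A₁ A₂ A₃ A₄ w ⟩
  A₁ * w + A₂ * w + A₃ * w + A₄ * w * 2
    ≡⟨ cong₂ _+_ (cong₂ _+_ (cong₂ _+_ (leaves r eq) (lefts b eq)) (rights c eq)) (twos d eq) ⟩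
  (suc r + d) * (2 ^ d * (r * n !)) + b * (2 ^ d * (suc r * n !)) +
  c * (2 ^ d * (suc r * n !)) + d * (2 ^ d * (suc (suc r) * n !))
    ≡⟨ collect r b c d (2 ^ d) (n !) ⟩
  2 ^ d * (suc r * ((r + b + c + (d + d)) * n !))
    ≡⟨ cong (λ x → 2 ^ d * (suc r * (x * n !))) eq ⟨
  2 ^ d * (suc r * (suc n) !) ∎
  where
  open ≡-Reasoning
  A₁ = forests r (suc n) c d
  A₂ = forests (suc r) (suc n) c d
  A₃ = shift (λ c′ → forests (suc r) (suc n) c′ d) c
  A₄ = shift (λ d′ → forests (suc (suc r)) (suc n) c d′) d
  w = weight (suc r + d) b c d

  distribute : ∀ A₁ A₂ A₃ A₄ w →
    (A₁ + (A₂ + (A₃ + 2 * A₄))) * w ≡ A₁ * w + A₂ * w + A₃ * w + A₄ * w * 2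
  distribute = solve-∀

  collect : ∀ r b c d p f →
    (suc r + d) * (p * (r * f)) + b * (p * (suc r * f)) +
    c * (p * (suc r * f)) + d * (p * (suc (suc r) * f)) ≡
    p * (suc r * ((r + b + c + (d + d)) * f))
  collect = solve-∀

  leaves : ∀ r → suc n ≡ r + b + c + (d + d) →
    forests r (suc n) c d * weight (suc r + d) b c d ≡ (suc r + d) * (2 ^ d * (r * n !))
  -- Without trees there are no vertices, so the left side is 0; the right side has the factor r =
  -- 0.
  leaves zero    _ = sym (trans (cong (suc d *_) (*-zeroʳ (2 ^ d))) (*-zeroʳ (suc d)))
  leaves (suc r) eq = trans
    (pull (forests (suc r) (suc n) c d) (suc (suc r) + d) ((suc r + d) !) (b !) (c !) (d !))
    (cong ((suc (suc r) + d) *_) (forests-weight n r b c d (suc-injective eq)))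
    where
    pull : ∀ F x a b c d → F * (x * a * b * c * d) ≡ x * (F * (a * b * c * d))
    pull = solve-∀

  lefts : ∀ b → suc n ≡ r + b + c + (d + d) →
    forests (suc r) (suc n) c d * weight (suc r + d) b c d ≡ b * (2 ^ d * (suc r * n !))
  -- With b = 0 the size `suc n` is r + c + 2 d, one below the least size of a forest of r + 1
  -- trees.
  lefts zero eq = cong (_* weight (suc r + d) 0 c d) (forests≡0 (suc r) (suc n) c d
    (s≤s (≤-reflexive (trans eq (cong (λ x → x + c + (d + d)) (+-identityʳ r))))))
  lefts (suc b) eq = trans
    (pull (forests (suc r) (suc n) c d) (suc b) ((suc r + d) !) (b !) (c !) (d !))
    (cong (suc b *_) (forests-weight n r b c d (suc-injective (trans eq (regroup r b c d)))))
    where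
    pull : ∀ F x a b c d → F * (a * (x * b) * c * d) ≡ x * (F * (a * b * c * d))
    pull = solve-∀
    regroup : ∀ r b c d → r + suc b + c + (d + d) ≡ suc (r + b + c + (d + d))
    regroup = solve-∀

  rights : ∀ c → suc n ≡ r + b + c + (d + d) →
    shift (λ c′ → forests (suc r) (suc n) c′ d) c * weight (suc r + d) b c d ≡
    c * (2 ^ d * (suc r * n !))
  rights zero _ = refl
  rights (suc c) eq = trans
    (pull (forests (suc r) (suc n) c d) (suc c) ((suc r + d) !) (b !) (c !) (d !))
    (cong (suc c *_) (forests-weight n r b c d (suc-injective (trans eq (regroup r b c d)))))
    where
    pull : ∀ F x a b c d → F * (a * b * (x * c) * d) ≡ x * (F * (a * b * c * d))
    pull = solve-∀
    regroup : ∀ r b c d → r + b + suc c + (d + d) ≡ suc (r + b + c + (d + d))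
    regroup = solve-∀

  twos : ∀ d → suc n ≡ r + b + c + (d + d) →
    shift (λ d′ → forests (suc (suc r)) (suc n) c d′) d * weight (suc r + d) b c d * 2 ≡
    d * (2 ^ d * (suc (suc r) * n !))
  twos zero _ = refl
  -- Deleting a root with two children keeps the leaves: `suc r + suc d` equals `suc (suc r) + d`.
  -- Its two labels raise `2 ^ d` to `2 ^ suc d`.
  twos (suc d) eq = begin
    F * weight (suc r + suc d) b c (suc d) * 2
      ≡⟨ cong (λ x → F * weight x b c (suc d) * 2) (+-suc (suc r) d) ⟩
    F * weight (suc (suc r) + d) b c (suc d) * 2
      ≡⟨ pull F (suc d) ((suc (suc r) + d) !) (b !) (c !) (d !) ⟩
    suc d * (2 * (F * weight (suc (suc r) + d) b c d))
      ≡⟨ cong (λ x → suc d * (2 * x))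
           (forests-weight n (suc r) b c d (suc-injective (trans eq (regroup r b c d)))) ⟩
    suc d * (2 * (2 ^ d * (suc (suc r) * n !)))
      ≡⟨ cong (suc d *_) (*-assoc 2 (2 ^ d) _) ⟨
    suc d * (2 ^ suc d * (suc (suc r) * n !)) ∎
    where
    F = forests (suc (suc r)) (suc n) c d
    pull : ∀ F x a b c d → F * (a * b * c * (x * d)) * 2 ≡ x * (2 * (F * (a * b * c * d)))
    pull = solve-∀
    regroup : ∀ r b c d → r + b + c + (suc d + suc d) ≡ suc (suc r + b + c + (d + d))
    regroup = solve-∀

-- From factorials to binomial coefficients

nCk*k!*[n∸k]!≡n! : ∀ {n k} → k ≤ n → (n C k) * (k ! * (n ∸ k) !) ≡ n !
nCk*k!*[n∸k]!≡n! {n} {k} k≤n = trans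
  (cong (_* (k ! * (n ∸ k) !)) (nCk≡n!/k![n-k]! k≤n))
  (m/n*n≡m {{k !* (n ∸ k) !≢0}} (subst (_∣ n !) (*-comm ((n ∸ k) !) (k !)) ([n∸k]!k!∣n! k≤n)))

[k+l]Ck*k!*l! : ∀ k l → ((k + l) C k) * (k ! * l !) ≡ (k + l) !
[k+l]Ck*k!*l! k l = trans (cong (λ x → ((k + l) C k) * (k ! * x !)) (sym (m+n∸m≡n k l)))
  (nCk*k!*[n∸k]!≡n! (m≤m+n k l))

-- Choose in stages: the c + d vertices with a right child, then the d of them with two children,
-- then the a leaves among the other a + b.
multinomial : ∀ a b c d →
  ((c + d + (a + b)) C (c + d)) * ((c + d) C d) * ((a + b) C a) * weight a b c d ≡ (c + d + (a + b)) !
multinomial a b c d = begin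
  N * ((c + d) C d) * ((a + b) C a) * weight a b c d
    ≡⟨ regroup N ((c + d) C d) ((a + b) C a) (a !) (b !) (c !) (d !) ⟩
  N * ((((c + d) C d) * (d ! * c !)) * (((a + b) C a) * (a ! * b !)))
    ≡⟨ cong (N *_) (cong₂ _*_
         (trans (cong (λ x → (x C d) * (d ! * c !)) (+-comm c d))
           (trans ([k+l]Ck*k!*l! d c) (cong _! (+-comm d c)))) ([k+l]Ck*k!*l! a b)) ⟩
  N * ((c + d) ! * (a + b) !)
    ≡⟨ [k+l]Ck*k!*l! (c + d) (a + b) ⟩
  (c + d + (a + b)) ! ∎
  where
  open ≡-Reasoning
  N = (c + d + (a + b)) C (c + d)
  regroup : ∀ N x y a b c d → N * x * y * (a * b * c * d) ≡ N * ((x * (d * c)) * (y * (a * b)))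
  regroup = solve-∀

weight≢0 : ∀ a b c d → NonZero (weight a b c d)
weight≢0 a b c d = m*n≢0 (a ! * b ! * c !) (d !)
  {{m*n≢0 (a ! * b !) (c !) {{a !* b !≢0}} {{c !≢0}}}} {{d !≢0}}

-- A single tree has `suc d` leaves. The factor n turns the (n - 1)! of `forests-weight` into the n!
-- of `multinomial`, after which the weight cancels.
n*forests-suc : ∀ b c d → let n = c + d + (suc d + b) in
  n * forests 1 n c d ≡ (n C (c + d)) * (2 ^ d * ((c + d) C d) * ((suc d + b) C (suc d)))
n*forests-suc b c d = *-cancelʳ-≡ _ _ w {{weight≢0 (suc d) b c d}} (begin
  n * forests 1 n c d * w
    ≡⟨ cong (λ x → x * forests 1 x c d * w) n≡ ⟩
  suc k * forests 1 (suc k) c d * w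
    ≡⟨ *-assoc (suc k) (forests 1 (suc k) c d) w ⟩
  suc k * (forests 1 (suc k) c d * w)
    ≡⟨ cong (suc k *_) (forests-weight k 0 b c d refl) ⟩
  suc k * (2 ^ d * (1 * k !))
    ≡⟨ swap (suc k) (2 ^ d) (k !) ⟩
  2 ^ d * (suc k) !
    ≡⟨ cong (λ x → 2 ^ d * x !) n≡ ⟨
  2 ^ d * n !
    ≡⟨ cong (2 ^ d *_) (multinomial (suc d) b c d) ⟨
  2 ^ d * ((n C (c + d)) * ((c + d) C d) * ((suc d + b) C (suc d)) * w)
    ≡⟨ regroup (2 ^ d) (n C (c + d)) ((c + d) C d) ((suc d + b) C (suc d)) w ⟩
  (n C (c + d)) * (2 ^ d * ((c + d) C d) * ((suc d + b) C (suc d))) * w ∎)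
  where
  open ≡-Reasoning
  n = c + d + (suc d + b)
  k = b + c + (d + d)
  w = weight (suc d) b c d
  n≡ : n ≡ suc k
  n≡ = count b c d
    where
    count : ∀ b c d → c + d + (suc d + b) ≡ suc (b + c + (d + d))
    count = solve-∀
  swap : ∀ x p f → x * (p * (1 * f)) ≡ p * (x * f)
  swap = solve-∀
  regroup : ∀ p x y z w → p * (x * y * z * w) ≡ x * (p * y * z) * w
  regroup = solve-∀

-- Here x counts the vertices without a right child, `suc d` of which are leaves. The excess is b;
-- if x is too small, both the forest count and the last binomial vanish.
n*forests : ∀ x c d → let n = c + d + x in
  n * forests 1 n c d ≡ (n C (c + d)) * (2 ^ d * ((c + d) C d) * (x C (suc d)))
n*forests x c d with ≤-<-connex (suc d) x
... | inj₁ d<x with b , refl ← m≤n⇒∃[o]m+o≡n d<x = n*forests-suc b c d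
... | inj₂ x<1+d = begin
  n * forests 1 n c d
    ≡⟨ cong (n *_) (forests≡0 1 n c d n<) ⟩
  n * 0
    ≡⟨ *-zeroʳ n ⟩
  0
    ≡⟨ *-zeroʳ (n C (c + d)) ⟨
  (n C (c + d)) * 0
    ≡⟨ cong ((n C (c + d)) *_) (*-zeroʳ (2 ^ d * ((c + d) C d))) ⟨
  (n C (c + d)) * (2 ^ d * ((c + d) C d) * 0)
    ≡⟨ cong (λ y → (n C (c + d)) * (2 ^ d * ((c + d) C d) * y)) (k>n⇒nCk≡0 x<1+d) ⟨
  (n C (c + d)) * (2 ^ d * ((c + d) C d) * (x C (suc d))) ∎
  where
  open ≡-Reasoning
  n = c + d + x
  n< : n < 1 + c + (d + d)
  n< = s≤s (≤-trans (+-monoʳ-≤ (c + d) (s≤s⁻¹ x<1+d)) (≤-reflexive (+-assoc c d d)))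

term : ℕ → ℕ → ℕ → ℕ
term n k j = 2 ^ j * ((k ∸ 1) C j) * ((n ∸ k + 1) C (j + 1))

-- The instance c = `m ∸ j`, d = j, x = `n ∸ suc m + 1` of `n*forests`, for which c + d is m and c +
-- d + x is n.
n*forests≡term : ∀ n m j → m < n → j ≤ m →
  n * forests 1 n (m ∸ j) j ≡ (n C m) * term n (suc m) j
n*forests≡term n m j m<n j≤m = subst₂
  (λ m′ n′ → n′ * forests 1 n′ (m ∸ j) j ≡ (n′ C m′) * (2 ^ j * (m′ C j) * ((n ∸ suc m + 1) C (j + 1))))
  (m∸n+n≡m j≤m) n≡
  (subst (λ i → N * forests 1 N (m ∸ j) j ≡ (N C M) * (2 ^ j * (M C j) * ((n ∸ suc m + 1) C i)))
    (+-comm 1 j) (n*forests (n ∸ suc m + 1) (m ∸ j) j))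
  where
  open ≡-Reasoning
  M = m ∸ j + j
  N = M + (n ∸ suc m + 1)
  n≡ : N ≡ n
  n≡ = begin
    M + (n ∸ suc m + 1)      ≡⟨ cong₂ _+_ (m∸n+n≡m j≤m) (+-comm _ 1) ⟩
    m + suc (n ∸ suc m)      ≡⟨ +-suc m _ ⟩
    suc m + (n ∸ suc m)      ≡⟨ m+[n∸m]≡n m<n ⟩
    n                        ∎

sum-proportional : ∀ x y (f g : ℕ → ℕ) n → (∀ j → j < n → x * f j ≡ y * g j) →
  x * sum (applyUpTo f n) ≡ y * sum (applyUpTo g n)
sum-proportional x y f g zero    e = trans (*-zeroʳ x) (sym (*-zeroʳ y))
sum-proportional x y f g (suc n) e = begin
  x * (f 0 + sum (applyUpTo (f ∘ suc) n))      ≡⟨ *-distribˡ-+ x (f 0) _ ⟩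
  x * f 0 + x * sum (applyUpTo (f ∘ suc) n)    ≡⟨ cong₂ _+_ (e 0 z<s)
    (sum-proportional x y (f ∘ suc) (g ∘ suc) n λ j j<n → e (suc j) (s<s j<n)) ⟩
  y * g 0 + y * sum (applyUpTo (g ∘ suc) n)    ≡⟨ *-distribˡ-+ y (g 0) _ ⟨
  y * (g 0 + sum (applyUpTo (g ∘ suc) n))      ∎
  where open ≡-Reasoning

-- The formula cleared of its denominator: n and `n C (k ∸ 1)` do not depend on j, so the termwise
-- identities add up.
n*BoNa : ∀ n k .{{_ : NonZero k}} → k ≤ n →
  n * BoNa n k ≡ (n C (k ∸ 1)) * sum (map (term n k) (upTo k))
n*BoNa n (suc m) m<n = begin
  n * BoNa n (suc m)
    ≡⟨ cong (n *_) (BoNa≡sum n m) ⟩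
  n * sum (applyUpTo (λ j → forests 1 n (m ∸ j) j) (suc m))
    ≡⟨ sum-proportional n (n C m) _ (term n (suc m)) (suc m)
         (λ j j≤m → n*forests≡term n m j m<n (s≤s⁻¹ j≤m)) ⟩
  (n C m) * sum (applyUpTo (term n (suc m)) (suc m))
    ≡⟨ cong (λ xs → (n C m) * sum xs) (map-upTo (term n (suc m)) (suc m)) ⟨
  (n C m) * sum (map (term n (suc m)) (upTo (suc m))) ∎
  where open ≡-Reasoning

-- Passing to rational numbers

-- Reduction to lowest terms hides p and n; the unreduced fraction exposes them for
-- cross-multiplication.
toℚᵘ-/ : ∀ p n .{{_ : NonZero n}} → ℚ.toℚᵘ (p / n) ℚᵘ.≃ p ℚᵘ./ n
toℚᵘ-/ p (suc n) = ℚ.toℚᵘ-fromℚᵘ (ℚᵘ.mkℚᵘ p n)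

-- Clearing denominators gives 2 k ≤ n + 1, and n + 1 ≤ 2 n because n is positive.
k/1≤[n+1]/2⇒k≤n : ∀ n k .{{_ : NonZero n}} → (+ k / 1) ℚ.≤ (+ (n + 1) / 2) → k ≤ n
k/1≤[n+1]/2⇒k≤n n k h = *-cancelʳ-≤ k n 2 (begin
  k * 2      ≤⟨ 2k≤n+1 ⟩
  n + 1      ≤⟨ +-monoʳ-≤ n (>-nonZero⁻¹ n) ⟩
  n + n      ≡⟨ double n ⟩
  n * 2      ∎)
  where
  open ≤-Reasoning
  double : ∀ n → n + n ≡ n * 2
  double = solve-∀
  h′ : (+ k ℚᵘ./ 1) ℚᵘ.≤ (+ (n + 1) ℚᵘ./ 2)
  h′ = ℚᵘ.≤-respˡ-≃ (toℚᵘ-/ (+ k) 1) (ℚᵘ.≤-respʳ-≃ (toℚᵘ-/ (+ (n + 1)) 2) (ℚ.toℚᵘ-mono-≤ h))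
  2k≤n+1 : k * 2 ≤ n + 1
  2k≤n+1 = ℤ.drop‿+≤+ (subst₂ ℤ._≤_ (sym (ℤ.pos-* k 2)) (ℤ.*-identityʳ (+ (n + 1)))
    (ℚᵘ.drop-*≤* h′))

n*a≡b*c⇒a≡1/n*b*c : ∀ n a b c .{{_ : NonZero n}} → n * a ≡ b * c →
  (+ a / 1) ≡ (+ 1 / n) ℚ.* (+ b / 1) ℚ.* (+ c / 1)
n*a≡b*c⇒a≡1/n*b*c n@(suc _) a b c eq = ℚ.toℚᵘ-injective (begin
  ℚ.toℚᵘ (+ a / 1)
    ≈⟨ toℚᵘ-/ (+ a) 1 ⟩
  + a ℚᵘ./ 1
    ≈⟨ ℚᵘ.*≡* cross ⟩
  (+ 1 ℚᵘ./ n) ℚᵘ.* (+ b ℚᵘ./ 1) ℚᵘ.* (+ c ℚᵘ./ 1)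
    ≈⟨ ℚᵘ.*-cong (ℚᵘ.*-cong (toℚᵘ-/ (+ 1) n) (toℚᵘ-/ (+ b) 1)) (toℚᵘ-/ (+ c) 1) ⟨
  ℚ.toℚᵘ (+ 1 / n) ℚᵘ.* ℚ.toℚᵘ (+ b / 1) ℚᵘ.* ℚ.toℚᵘ (+ c / 1)
    ≈⟨ ℚᵘ.*-congʳ (ℚ.toℚᵘ-homo-* (+ 1 / n) (+ b / 1)) ⟨
  ℚ.toℚᵘ ((+ 1 / n) ℚ.* (+ b / 1)) ℚᵘ.* ℚ.toℚᵘ (+ c / 1)
    ≈⟨ ℚ.toℚᵘ-homo-* ((+ 1 / n) ℚ.* (+ b / 1)) (+ c / 1) ⟨
  ℚ.toℚᵘ ((+ 1 / n) ℚ.* (+ b / 1) ℚ.* (+ c / 1)) ∎)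
  where
  open ℚᵘ.≃-Reasoning
  -- The three denominators on the right multiply to `n * 1 * 1`, and the final `+ 1` is the
  -- denominator of a.
  cross : + a ℤ.* + (n * 1 * 1) ≡ + 1 ℤ.* + b ℤ.* + c ℤ.* + 1
  cross = trans (sym (ℤ.pos-* a (n * 1 * 1))) (trans (cong +_ nat)
    (trans (ℤ.pos-* b c) (sym (trans (ℤ.*-identityʳ _)
      (cong (ℤ._* + c) (ℤ.*-identityˡ (+ b)))))))
    where
    nat : a * (n * 1 * 1) ≡ b * c
    nat = trans (cong (a *_) (trans (*-identityʳ _) (*-identityʳ n)))
      (trans (*-comm a n) eq)

theorem3p2 : (n k : ℕ) .{{_ : NonZero n}} .{{_ : NonZero k}} →
    (+ k / 1) ℚ.≤ (+ (n + 1) / 2) →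
    (+ BoNa n k / 1) ≡
    (+ 1 / n) ℚ.* (+ (n C (k ∸ 1)) / 1) ℚ.*
    (+ sum (map (λ j → 2 ^ j * ((k ∸ 1) C j) * ((n ∸ k + 1) C (j + 1))) (upTo k)) / 1)
theorem3p2 n k h = n*a≡b*c⇒a≡1/n*b*c n (BoNa n k) (n C (k ∸ 1)) (sum (map (term n k) (upTo k)))
  (n*BoNa n k (k/1≤[n+1]/2⇒k≤n n k h))
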